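{- Let $r\ge 5$ be an integer. Then (a) $F_v(2_r;r-2)\ge r+9$; (b) $F_v(2_r;r-2)=r+9$ if $r\ge 8$.
   Context: All graphs are finite, undirected, without loops or multiple edges. For a graph $G$, $\omega(G)$ denotes the clique number. For positive integers $a_1,\dots,a_r$, $G\to^v(a_1,\dots,a_r)$ means that for every partition $V(G)=V_1\cup\dots\cup V_r$ into pairwise disjoint (possibly empty) sets there is an $i$ such that $V_i$ contains an $a_i$-clique. Write $(2_r)$ for the $r$-tuple $(2,\dots,2)$; thus $G\to^v(2_r)$ is equivalent to $\chi(G)\ge r+1$. For an integer $q$, $H_v(2_r;q)$ is the set of graphs $G$ with $G\to^v(2_r)$ and $\omega(G)<q$, and $F_v(2_r;q)=\min\{|V(G)|: G\in H_v(2_r;q)\}$ (it exists whenever $q\ge 3$). -}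

module Defs where

open import Data.Nat using (ℕ; _≤_; _<_)
open import Data.Fin using (Fin)
open import Data.Product using (Σ; _×_; ∃)
open import Function.Definitions using (Injective)
open import Relation.Binary.PropositionalEquality using (_≡_)
open import Relation.Nullary using (¬_)
open import Data.Bool using (Bool; true; false)

record Graph (n : ℕ) : Set where
  field
    adj : Fin n → Fin n → Bool
    sym : ∀ u v → adj u v ≡ adj v u
    irrefl : ∀ v → adj v v ≡ false
open Graph public

Adj : ∀ {n} → Graph n → Fin n → Fin n → Set
Adj G u v = adj G u v ≡ true

Clique : ∀ {n} → Graph n → ℕ → Set
Clique {n} G k = Σ (Fin k → Fin n) λ f →
  Injective _≡_ _≡_ f × (∀ i j → ¬ i ≡ j → Adj G (f i) (f j))

CliqueNumberBelow : ∀ {n} → Graph n → ℕ → Set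
CliqueNumberBelow G q = ¬ Clique G q

-- G →v (2_r): for every partition of V(G) into r (possibly empty) parts,
-- some part contains a 2-clique (i.e. an edge).  A partition into r parts
-- V_1,...,V_r is given by the map c : Fin n → Fin r sending v to its part.
-- A 2-clique inside a part is the same as an edge with both ends in it.
Arrows2 : ∀ {n} → Graph n → ℕ → Set
Arrows2 {n} G r = (c : Fin n → Fin r) →
  Σ (Fin r) λ i → Clique2In i c
  where
  Clique2In : Fin r → (Fin n → Fin r) → Set
  Clique2In i c = Σ (Clique G 2) λ K → ∀ j → c (Σ.proj₁ K j) ≡ i

InHv : ∀ {n} → Graph n → ℕ → ℕ → Set
InHv G r q = Arrows2 G r × CliqueNumberBelow G q

IsFv : ℕ → ℕ → ℕ → Set
IsFv r q m = (Σ (Graph m) λ G → InHv G r q)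
           × (∀ n (G : Graph n) → InHv G r q → m ≤ n)

{-# OPTIONS --safe #-}
module Submission where

-- Lower bound.  Deleting an independent triple lowers the order by 3 and the chromatic number by at
-- most 1.  By induction on j ≤ 4, a vertex set S which is not c-colourable and has clique number at
-- most c + 1 - j satisfies |S| ≥ c + 1 + 2j, provided this holds when S has no independent triple.
-- Then the complement H of G[S] is triangle-free, and a k-matching of H colours S with |S| - k colours,
-- so it suffices to show |S| ≤ ω + k + ⌊k/2⌋ when H has matching number k ≤ 7.  A vertex lying in all
-- maximum matchings of H may be deleted.  Otherwise, as in Gallai's lemma, "no maximum matching avoids
-- both u and v" is an equivalence relation that contains the edges of H; a class C with matching
-- number k₁ has at most 2k₁ + 1 vertices, and R(3,a) ≤ a(a+1)/2 yields a clique of G in C of order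
-- at least |C| - k₁ - ⌊k₁/2⌋, to which the bound for S ∖ C is added.
--
-- Upper bound.  For r ≥ 8, join a complete graph to the complement of a 17-vertex graph showing
-- R(3,6) > 17.  For r ≥ 5, shift graphs are triangle-free of large chromatic number, and
-- the minimum is found by exhaustive search.

open import Defs
open import Data.Bool using (Bool; true; false; if_then_else_)
import Data.Bool.Properties as Bool
open import Data.Fin as Fin using (Fin; zero; suc; toℕ; fromℕ<; combine; remQuot; funToFin; finToFun; punchOut)
import Data.Fin.Properties as Fin
open import Data.List using (List; []; _∷_; length; filter; allFin)
open import Data.List.Properties using (filter-notAll; filter-all; length-tabulate)
open import Data.List.Membership.Propositional using (_∈_; _∉_; lose)
open import Data.List.Membership.Propositional.Properties using (∈-filter⁺; ∈-filter⁻; ∈-allFin)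
open import Data.List.Relation.Unary.Any using (here; there)
open import Data.List.Relation.Unary.All as All using (_∷_)
open import Data.List.Relation.Unary.AllPairs using ([]; _∷_)
open import Data.List.Relation.Unary.Unique.Propositional using (Unique)
import Data.List.Relation.Unary.Unique.Propositional.Properties as Unique
open import Data.Nat using (ℕ; zero; suc; _+_; _*_; _^_; _∸_; _≤_; _<_; _≤?_; z≤n; s≤s; ⌊_/2⌋)
open import Data.Nat.Properties
open import Data.List.Membership.DecPropositional _≟_ using (_∈?_)
open import Data.Nat.Solver using (module +-*-Solver)
open import Data.Product using (Σ; ∃-syntax; ∃₂; _×_; _,_; proj₁; proj₂)
open import Data.Sum as Sum using (_⊎_; inj₁; inj₂; [_,_])
open import Data.Unit using (⊤; tt)
open import Data.Vec using (Vec; []; _∷_; lookup)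
open import Effect.Monad using (RawMonad)
open import Function using (_∘_; id)
open import Level using (0ℓ)
open import Relation.Binary using (Rel; Symmetric) renaming (Decidable to Decidable₂)
open import Relation.Binary.PropositionalEquality as ≡ using (_≡_; _≢_; refl; cong; subst; subst₂)
open import Relation.Nullary using (¬_; Dec; yes; no; does; contradiction; ¬?)
open import Relation.Nullary.Decidable
  using (decidable-stable; ¬¬-excluded-middle; from-yes; from-no; map′; dec-true; dec-false;
         _→-dec_; _×-dec_; _⊎-dec_)
open import Relation.Nullary.Negation using (¬¬-Monad)
open import Relation.Unary using (Pred; _⊆_; Decidable)

-- Finite choice under double negation; lists of vertices

-- Provides classical case distinctions on all vertices at once, inside the proof of a decidable
-- goal.
¬¬-decidable : ∀ {n} (P : Pred (Fin n) 0ℓ) → ¬ ¬ Decidable P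
¬¬-decidable P = Fin.sequence (RawMonad.rawApplicative ¬¬-Monad) (λ _ → ¬¬-excluded-middle)

length-filter-+ : ∀ {A : Set} {P : Pred A 0ℓ} (P? : Decidable P) xs →
  length (filter P? xs) + length (filter (¬? ∘ P?) xs) ≡ length xs
length-filter-+ P? [] = refl
length-filter-+ P? (x ∷ xs) with P? x
... | yes _ = cong suc (length-filter-+ P? xs)
... | no _ = ≡.trans (+-suc _ _) (cong suc (length-filter-+ P? xs))

module _ {n : ℕ} where

  infixl 6 _∖_

  _∖_ : Pred (Fin n) 0ℓ → Fin n → Pred (Fin n) 0ℓ
  (P ∖ x) v = P v × v ≢ x

  delete : Fin n → List (Fin n) → List (Fin n)
  delete x = filter (λ v → ¬? (v Fin.≟ x))

  ∈-delete⁺ : ∀ {S x} → (_∈ S) ∖ x ⊆ (_∈ delete x S)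
  ∈-delete⁺ {x = x} (v∈S , v≢x) = ∈-filter⁺ (λ v → ¬? (v Fin.≟ x)) v∈S v≢x

  ∈-delete⁻ : ∀ {S x} → (_∈ delete x S) ⊆ (_∈ S) ∖ x
  ∈-delete⁻ {x = x} = ∈-filter⁻ (λ v → ¬? (v Fin.≟ x))

  unique-delete : ∀ {S} x → Unique S → Unique (delete x S)
  unique-delete x = Unique.filter⁺ (λ v → ¬? (v Fin.≟ x))

  length-delete-< : ∀ {S x} → x ∈ S → length (delete x S) < length S
  length-delete-< {S} x∈S = filter-notAll _ S (lose x∈S (λ x≢x → x≢x refl))

  length-delete-≥ : ∀ {S} x → Unique S → length S ≤ suc (length (delete x S))
  length-delete-≥ {[]} x [] = z≤n
  length-delete-≥ {v ∷ S} x (v∉S ∷ u) with v Fin.≟ x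
  ... | yes refl = s≤s (≤-reflexive (≡.sym (cong length
                     (filter-all (λ w → ¬? (w Fin.≟ v)) (All.map (λ v≢w w≡v → v≢w (≡.sym w≡v)) v∉S)))))
  ... | no _ = s≤s (length-delete-≥ x u)

  length-delete₂-≥ : ∀ {S} x y → Unique S → length S ≤ 2 + length (delete y (delete x S))
  length-delete₂-≥ x y u =
    ≤-trans (length-delete-≥ x u) (s≤s (length-delete-≥ y (unique-delete x u)))

-- Adjacency and matchings of the complement

module _ {n : ℕ} (G : Graph n) where

  Adj? : ∀ u v → Dec (Adj G u v)
  Adj? u v = adj G u v Bool.≟ true

  Adj-sym : ∀ {u v} → Adj G u v → Adj G v u
  Adj-sym {u} {v} a = ≡.trans (sym G v u) a

  Adj-irrefl : ∀ {v} → ¬ Adj G v v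
  Adj-irrefl {v} a = contradiction (≡.trans (≡.sym a) (irrefl G v)) λ ()

  NonAdj : Fin n → Fin n → Set
  NonAdj u v = u ≢ v × ¬ Adj G u v

  NonAdj-sym : ∀ {u v} → NonAdj u v → NonAdj v u
  NonAdj-sym (u≢v , ¬a) = u≢v ∘ ≡.sym , ¬a ∘ Adj-sym

  ¬NonAdj⇒Adj : ∀ {u v} → u ≢ v → ¬ NonAdj u v → Adj G u v
  ¬NonAdj⇒Adj {u} {v} u≢v ¬na = decidable-stable (Adj? u v) (λ ¬a → ¬na (u≢v , ¬a))

  -- Matchings of the complement of G.
  data Matching (P : Pred (Fin n) 0ℓ) : ℕ → Set where
    []   : Matching P 0
    edge : ∀ {k x y} → P x → P y → NonAdj x y → Matching (P ∖ x ∖ y) k → Matching P (suc k)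

  matching-mono : ∀ {P Q k} → P ⊆ Q → Matching P k → Matching Q k
  matching-mono f [] = []
  matching-mono f (edge px py e m) =
    edge (f px) (f py) e (matching-mono (λ ((p , a) , b) → (f p , a) , b) m)

  data Pick (P : Pred (Fin n) 0ℓ) (t : Fin n) : ℕ → Set where
    avoided : ∀ {k} → Matching (P ∖ t) k → Pick P t k
    matched : ∀ {k y} → P t → P y → NonAdj t y → Matching (P ∖ t ∖ y) k → Pick P t (suc k)

  -- The edges of a matching are disjoint and so commute: an edge at `t` can be moved to the front.
  pick : ∀ {P k} t → Matching P k → Pick P t k
  pick t [] = avoided []
  pick t (edge {x = x} {y} px py e m) with x Fin.≟ t | y Fin.≟ t
  ... | yes refl | _ = matched px py e m
  ... | no _ | yes refl =
    matched py px (NonAdj-sym e) (matching-mono (λ ((p , a) , b) → (p , b) , a) m)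
  ... | no x≢t | no y≢t with pick t m
  ...   | avoided m′ =
    avoided (edge (px , x≢t) (py , y≢t) e (matching-mono (λ (((p , a) , b) , c) → ((p , c) , a) , b) m′))
  ...   | matched ((pt , _) , _) ((pz , z≢x) , z≢y) e′ m′ =
    matched pt pz e′ (edge ((px , x≢t) , z≢x ∘ ≡.sym) ((py , y≢t) , z≢y ∘ ≡.sym) e
      (matching-mono (λ ((((p , a) , b) , c) , d) → (((p , c) , d) , a) , b) m′))

  -- Following the alternating path of M and N that starts at t.
  exchange : ∀ {k P t u v} → u ≢ v → P t → t ≢ u → t ≢ v →
    Matching (P ∖ u ∖ v) k → Matching (P ∖ t) k →
    Matching P (suc k) ⊎ Matching (P ∖ t ∖ u) k ⊎ Matching (P ∖ t ∖ v) k
  exchange {k} {P} {t} {u} {v} u≢v pt t≢u t≢v M N with pick t M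
  ... | avoided M′ = inj₂ (inj₁ (matching-mono (λ (((p , a) , b) , c) → (p , c) , a) M′))
  ... | matched {y = y} _ ((py , y≢u) , y≢v) t-y M′ with pick y N
  ...   | avoided N′ = inj₁ (edge pt py t-y N′)
  ...   | matched {k = k′} {y = z} (_ , y≢t) (pz , z≢t) y-z N′ with z Fin.≟ u | z Fin.≟ v
  -- The path arrives at `u`: `M′` with the edge from `y` to `u` has `k` edges again and misses `t`
  -- and `v`.
  ...     | yes refl | _ = inj₂ (inj₂ (edge ((py , y≢t) , y≢v) ((pz , z≢t) , u≢v) y-z
              (matching-mono (λ ((((p , a) , b) , c) , d) → (((p , c) , b) , d) , a) M′)))
  ...     | no _ | yes refl = inj₂ (inj₁ (edge ((py , y≢t) , y≢u) ((pz , z≢t) , u≢v ∘ ≡.sym) y-z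
              (matching-mono (λ ((((p , a) , b) , c) , d) → (((p , c) , a) , d) , b) M′)))
  -- Continue from `z`. An enlarged matching is completed by the edge `t`-`y`, one of the other two
  -- by `y`-`z`.
  ...     | no z≢u | no z≢v
    with exchange {k′} {P ∖ t ∖ y} u≢v ((pz , z≢t) , proj₁ y-z ∘ ≡.sym) z≢u z≢v
           (matching-mono (λ ((((p , a) , b) , c) , d) → (((p , c) , d) , a) , b) M′) N′
  ...       | inj₁ L = inj₁ (edge pt py t-y L)
  ...       | inj₂ (inj₁ L) = inj₂ (inj₁ (edge ((py , y≢t) , y≢u) ((pz , z≢t) , z≢u) y-z
              (matching-mono (λ ((((p , a) , b) , c) , d) → (((p , a) , d) , b) , c) L)))
  ...       | inj₂ (inj₂ L) = inj₂ (inj₂ (edge ((py , y≢t) , y≢v) ((pz , z≢t) , z≢v) y-z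
              (matching-mono (λ ((((p , a) , b) , c) , d) → (((p , a) , d) , b) , c) L)))

  matching-∪ : ∀ {P Q R a b} → P ⊆ R → Q ⊆ R → (∀ {v} → P v → ¬ Q v) →
    Matching P a → Matching Q b → Matching R (a + b)
  matching-∪ f g dis [] N = matching-mono g N
  matching-∪ f g dis (edge px py e M) N = edge (f px) (f py) e
    (matching-∪ (λ ((p , a) , b) → (f p , a) , b)
                (λ q → (g q , λ { refl → dis px q }) , λ { refl → dis py q })
                (λ ((p , _) , _) → dis p) M N)

  matching-split : ∀ {P Q R k} → R ⊆ (λ v → P v ⊎ Q v) → (∀ {x y} → P x → Q y → ¬ NonAdj x y) →
    Matching R k → ∃₂ λ a b → a + b ≡ k × Matching P a × Matching Q b
  matching-split cover cross [] = 0 , 0 , refl , [] , []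
  matching-split {P} {Q} cover cross (edge {x = x} {y} rx ry e M)
    with a , b , refl , A , B ← matching-split {P ∖ x ∖ y} {Q ∖ x ∖ y}
           (λ ((r , c) , d) → [ (λ p → inj₁ ((p , c) , d)) , (λ q → inj₂ ((q , c) , d)) ] (cover r))
           (λ ((p , _) , _) ((q , _) , _) → cross p q) M
    with cover rx | cover ry
  ... | inj₁ px | inj₁ py = suc a , b , refl , edge px py e A , matching-mono (proj₁ ∘ proj₁) B
  ... | inj₁ px | inj₂ qy = contradiction e (cross px qy)
  ... | inj₂ qx | inj₁ py = contradiction (NonAdj-sym e) (cross py qx)
  ... | inj₂ qx | inj₂ qy = a , suc b , +-suc a b , matching-mono (proj₁ ∘ proj₁) A , edge qx qy e B

  -- A `k`-matching covers `2k` vertices; deleting both ends of an edge shortens the duplicate-free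
  -- `S` by at most two.
  matching-misses-two : ∀ {k S} → Unique S → 2 + (k + k) ≤ length S → Matching (_∈ S) k →
    ∃₂ λ x y → x ∈ S × y ∈ S × x ≢ y × Matching ((_∈ S) ∖ x ∖ y) k
  matching-misses-two {S = x ∷ y ∷ _} ((x≢y ∷ _) ∷ _) _ [] =
    x , y , here refl , there (here refl) , x≢y , []
  matching-misses-two {S = _ ∷ []} _ (s≤s ()) []
  matching-misses-two {suc k} {S} u big (edge {x = a} {b} a∈S b∈S e M)
    with x , y , x∈ , y∈ , x≢y , M′ ← matching-misses-two (unique-delete b (unique-delete a u))
                              (+-cancelˡ-≤ 2 _ _ (≤-trans (≤-reflexive (cong (3 +_) (≡.sym (+-suc k k))))
                                (≤-trans big (length-delete₂-≥ a b u))))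
                              (matching-mono (λ ((s , p) , q) → ∈-delete⁺ (∈-delete⁺ (s , p) , q)) M)
    with (x∈ , x≢b) ← ∈-delete⁻ x∈ | (y∈ , y≢b) ← ∈-delete⁻ y∈
    with (x∈S , x≢a) ← ∈-delete⁻ x∈ | (y∈S , y≢a) ← ∈-delete⁻ y∈ =
      x , y , x∈S , y∈S , x≢y ,
      edge ((a∈S , x≢a ∘ ≡.sym) , y≢a ∘ ≡.sym) ((b∈S , x≢b ∘ ≡.sym) , y≢b ∘ ≡.sym) e
        (matching-mono (λ ((s , p) , q) → let (s′ , sb) = ∈-delete⁻ s ; (s″ , sa) = ∈-delete⁻ s′ in
                          (((s″ , p) , q) , sa) , sb) M′)

  -- Cliques in a vertex set and a Ramsey bound

  data CliqueIn (P : Pred (Fin n) 0ℓ) : ℕ → Set where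
    []  : CliqueIn P 0
    _∷_ : ∀ {k x} → P x → CliqueIn (λ y → P y × Adj G x y) k → CliqueIn P (suc k)

  clique-mono : ∀ {P Q k} → P ⊆ Q → CliqueIn P k → CliqueIn Q k
  clique-mono f [] = []
  clique-mono f (px ∷ K) = f px ∷ clique-mono (λ (p , a) → f p , a) K

  clique-shrink : ∀ {P k l} → k ≤ l → CliqueIn P l → CliqueIn P k
  clique-shrink z≤n _ = []
  clique-shrink (s≤s k≤l) (px ∷ K) = px ∷ clique-shrink k≤l K

  clique-join : ∀ {P Q R a b} → P ⊆ R → Q ⊆ R → (∀ {x y} → P x → Q y → Adj G x y) →
    CliqueIn P a → CliqueIn Q b → CliqueIn R (a + b)
  clique-join f g cross [] L = clique-mono g L
  clique-join f g cross (px ∷ K) L =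
    f px ∷ clique-join (λ (p , a) → f p , a) (λ q → g q , cross px q) (λ (p , _) → cross p) K L

  pairwise-adjacent-clique : ∀ {S} → Unique S → (∀ {x y} → x ∈ S → y ∈ S → x ≢ y → Adj G x y) →
    CliqueIn (_∈ S) (length S)
  pairwise-adjacent-clique {[]} _ _ = []
  pairwise-adjacent-clique {x ∷ S} (x∉S ∷ u) a = here refl ∷ clique-mono
    (λ v∈S → there v∈S , a (here refl) (there v∈S) (All.lookup x∉S v∈S))
    (pairwise-adjacent-clique u (λ p q → a (there p) (there q)))

  NoIndependentTriple : Pred (Fin n) 0ℓ → Set
  NoIndependentTriple P = ∀ {x y z} → P x → P y → P z → NonAdj x y → NonAdj x z → ¬ NonAdj y z

  triangular : ℕ → ℕ
  triangular zero = 0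
  triangular (suc a) = suc (a + triangular a)

  -- Two non-adjacent non-neighbours of `x` would form an independent triple with it. So more than
  -- `a` non-neighbours contain the clique; otherwise `triangular a` neighbours remain, and `x`
  -- extends a clique among them.
  ramsey : ∀ a {S} → Unique S → NoIndependentTriple (_∈ S) → triangular a ≤ length S →
    CliqueIn (_∈ S) a
  ramsey zero _ _ _ = []
  ramsey (suc a) {x ∷ S} (x∉S ∷ u) tf (s≤s big) with a <? length Y
    where
    Y = filter (λ v → ¬? (Adj? x v)) S
  ... | yes a<Y = clique-shrink a<Y (clique-mono (there ∘ proj₁ ∘ ∈-filter⁻ (λ v → ¬? (Adj? x v)))
          (pairwise-adjacent-clique (Unique.filter⁺ (λ v → ¬? (Adj? x v)) u) adjacent))
    where
    nonadj : ∀ {v} → v ∈ filter (λ v → ¬? (Adj? x v)) S → v ∈ S × NonAdj x v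
    nonadj v∈ with v∈S , ¬a ← ∈-filter⁻ (λ v → ¬? (Adj? x v)) v∈ = v∈S , All.lookup x∉S v∈S , ¬a
    adjacent : ∀ {y z} → y ∈ filter (λ v → ¬? (Adj? x v)) S → z ∈ filter (λ v → ¬? (Adj? x v)) S →
      y ≢ z → Adj G y z
    adjacent y∈ z∈ y≢z with y∈S , ey ← nonadj y∈ | z∈S , ez ← nonadj z∈ =
      ¬NonAdj⇒Adj y≢z (tf (here refl) (there y∈S) (there z∈S) ey ez)
  ... | no a≮Y = here refl ∷ clique-mono (λ v∈ → let (v∈S , a) = ∈-filter⁻ (Adj? x) v∈ in there v∈S , a)
          (ramsey a (Unique.filter⁺ (Adj? x) u)
            (λ p q r → tf (sub p) (sub q) (sub r)) large)
    where
    sub : (_∈ filter (Adj? x) S) ⊆ (_∈ x ∷ S)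
    sub = there ∘ proj₁ ∘ ∈-filter⁻ (Adj? x)
    open ≤-Reasoning
    large : triangular a ≤ length (filter (Adj? x) S)
    large = +-cancelˡ-≤ a _ _ (begin
      a + triangular a                                    ≤⟨ big ⟩
      length S                                            ≡⟨ ≡.sym (length-filter-+ (Adj? x) S) ⟩
      length (filter (Adj? x) S) + length (filter (λ v → ¬? (Adj? x v)) S)
                                                          ≤⟨ +-monoʳ-≤ _ (≮⇒≥ a≮Y) ⟩
      length (filter (Adj? x) S) + a                      ≡⟨ +-comm _ a ⟩
      a + length (filter (Adj? x) S)                      ∎)

  -- Gallai's equivalence relation

  -- Meant for `k` the matching number. The clause `u ≡ v` gives reflexivity, as a `k`-matching may
  -- avoid a single vertex.
  Inseparable : Pred (Fin n) 0ℓ → ℕ → Fin n → Fin n → Set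
  Inseparable P k u v = u ≡ v ⊎ ¬ Matching (P ∖ u ∖ v) k

  inseparable-sym : ∀ {P k u v} → Inseparable P k u v → Inseparable P k v u
  inseparable-sym (inj₁ u≡v) = inj₁ (≡.sym u≡v)
  inseparable-sym (inj₂ ¬M) = inj₂ (¬M ∘ matching-mono (λ ((p , a) , b) → (p , b) , a))

  -- From a `k`-matching avoiding `u` and `v` and one avoiding `t`, `exchange` makes a larger
  -- matching or a `k`-matching avoiding `t` and one of `u`, `v`; all are excluded.
  inseparable-trans : ∀ {P k t u v} → ¬ Matching P (suc k) → P t → ¬ ¬ Matching (P ∖ t) k →
    Inseparable P k u t → Inseparable P k t v → Inseparable P k u v
  inseparable-trans _ _ _ (inj₁ refl) t~v = t~v
  inseparable-trans _ _ _ u~t (inj₁ refl) = u~t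
  inseparable-trans {t = t} {u} {v} max pt avoidable u~t@(inj₂ _) (inj₂ t~v)
    with u Fin.≟ v | t Fin.≟ u | t Fin.≟ v
  ... | yes u≡v | _ | _ = inj₁ u≡v
  ... | no _ | yes refl | _ = inj₂ t~v
  ... | no _ | no _ | yes refl = u~t
  ... | no u≢v | no t≢u | no t≢v with inseparable-sym u~t
  ...   | inj₁ t≡u = contradiction t≡u t≢u
  ...   | inj₂ t~u = inj₂ λ M → avoidable λ N →
            [ max , [ t~u , t~v ] ] (exchange u≢v pt t≢u t≢v M N)

  nonadjacent⇒inseparable : ∀ {P k u v} → ¬ Matching P (suc k) → P u → P v → NonAdj u v →
    Inseparable P k u v
  nonadjacent⇒inseparable max pu pv e = inj₂ (max ∘ edge pu pv e)

  -- Order bounded by clique number and matching number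

  -- Disjoint 5-cycles in the complement attain the bound: each adds 5 to the order and 2 to both
  -- clique number and matching number.
  excess : ℕ → ℕ
  excess k = k + ⌊ k /2⌋

  ⌊/2⌋-superadditive : ∀ a b → ⌊ a /2⌋ + ⌊ b /2⌋ ≤ ⌊ a + b /2⌋
  ⌊/2⌋-superadditive 0 b = ≤-refl
  ⌊/2⌋-superadditive 1 b = ⌊n/2⌋-mono (n≤1+n b)
  ⌊/2⌋-superadditive (suc (suc a)) b = s≤s (⌊/2⌋-superadditive a b)

  excess-superadditive : ∀ a b → excess a + excess b ≤ excess (a + b)
  excess-superadditive a b = ≤-trans
    (≤-reflexive (solve 4 (λ a a′ b b′ → (a :+ a′) :+ (b :+ b′) := (a :+ b) :+ (a′ :+ b′))
                    refl a ⌊ a /2⌋ b ⌊ b /2⌋))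
    (+-monoʳ-≤ (a + b) (⌊/2⌋-superadditive a b))
    where open +-*-Solver

  -- As `k ≤ 7` forces `m ≤ 15`, a finite check suffices. For `k = 7` and `m = 15` only `a = 5`
  -- works, with equality twice.
  ramsey-suffices : ∀ {k m} → k ≤ 7 → m ≤ suc (k + k) →
    ∃[ a ] triangular a ≤ m × m ≤ a + excess k
  ramsey-suffices {k} {m} k≤7 m≤ =
    let (a , p) = subst₂ Good (Fin.toℕ-fromℕ< k<8) (Fin.toℕ-fromℕ< m<16)
                   (table (fromℕ< k<8) (fromℕ< m<16)) m≤
    in toℕ a , p
    where
    Good : ℕ → ℕ → Set
    Good k m = m ≤ suc (k + k) → ∃[ a ] triangular (toℕ {6} a) ≤ m × m ≤ toℕ a + excess k
    table : ∀ (k : Fin 8) (m : Fin 16) → Good (toℕ k) (toℕ m)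
    table = from-yes (Fin.all? {8} λ k → Fin.all? {16} λ m → (toℕ m ≤? suc (toℕ k + toℕ k)) →-dec
              Fin.any? λ a → (triangular (toℕ {6} a) ≤? toℕ m) ×-dec (toℕ m ≤? toℕ a + excess (toℕ k)))
    k<8 : k < 8
    k<8 = s≤s k≤7
    m<16 : m < 16
    m<16 = s≤s (≤-trans m≤ (s≤s (+-mono-≤ k≤7 k≤7)))

  -- `C` is to be a class and `D` the rest. Pairs across are adjacent, so matchings of the
  -- complement split, cliques join, and the two bounds add up.
  split-bound : ∀ {k w S C D} → (_∈ S) ⊆ (λ v → v ∈ C ⊎ v ∈ D) → (_∈ C) ⊆ (_∈ S) → (_∈ D) ⊆ (_∈ S) →
    (∀ {v} → v ∈ C → ¬ v ∈ D) → Unique C → NoIndependentTriple (_∈ C) → k ≤ 7 →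
    (∀ {x y} → x ∈ C → y ∈ D → ¬ NonAdj x y) →
    (∀ {x y} → x ∈ C → y ∈ C → x ≢ y → ¬ Matching ((_∈ S) ∖ x ∖ y) k) →
    ¬ Matching (_∈ S) (suc k) → ¬ CliqueIn (_∈ S) (suc w) → Matching (_∈ S) k →
    (∀ {k w} → k ≤ 7 → ¬ Matching (_∈ D) (suc k) → ¬ CliqueIn (_∈ D) (suc w) →
      length D ≤ w + excess k) →
    length C + length D ≤ w + excess k
  split-bound {w = w} {S} {C} {D} cover C⊆S D⊆S disjoint u tf k≤7 cross tight max ω M boundD
    with k₁ , k₂ , refl , M₁ , M₂ ← matching-split cover cross M
    with length C ≤? 1 + (k₁ + k₁)
  -- With more than `2k₁ + 1` vertices in `C`, a `k₁`-matching would avoid two of them; with `M₂` it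
  -- is a `k`-matching of `S`, against `tight`.
  ... | no large with x , y , x∈ , y∈ , x≢y , M₁′ ← matching-misses-two u (≰⇒> large) M₁ =
    contradiction
      (matching-∪ (λ ((v∈C , p) , q) → (C⊆S v∈C , p) , q)
        (λ v∈D → (D⊆S v∈D , λ { refl → disjoint x∈ v∈D }) , λ { refl → disjoint y∈ v∈D })
        (λ ((v∈C , _) , _) → disjoint v∈C) M₁′ M₂)
      (tight x∈ y∈ x≢y)
  ... | yes |C|≤ with a , a≤ , ≤a ← ramsey-suffices (≤-trans (m≤m+n k₁ k₂) k≤7) |C|≤
    with K ← ramsey a u tf a≤ with a ≤? w
  ...   | no a≰w = contradiction (clique-shrink (≰⇒> a≰w) (clique-mono C⊆S K)) ω
  ...   | yes a≤w with w′ , refl ← m≤n⇒∃[o]m+o≡n a≤w = begin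
      length C + length D                      ≤⟨ +-mono-≤ ≤a (boundD (≤-trans (m≤n+m k₂ k₁) k≤7) max′ ω′) ⟩
      (a + excess k₁) + (w′ + excess k₂)       ≡⟨ solve 4 (λ a b c d → (a :+ b) :+ (c :+ d) := (a :+ c) :+ (b :+ d))
                                                    refl a (excess k₁) w′ (excess k₂) ⟩
      (a + w′) + (excess k₁ + excess k₂)       ≤⟨ +-monoʳ-≤ (a + w′) (excess-superadditive k₁ k₂) ⟩
      (a + w′) + excess (k₁ + k₂)              ∎
    where
    open ≤-Reasoning
    open +-*-Solver
    max′ : ¬ Matching (_∈ D) (suc k₂)
    max′ M₂′ = max (subst (Matching (_∈ S)) (+-suc k₁ k₂) (matching-∪ C⊆S D⊆S disjoint M₁ M₂′))
    ω′ : ¬ CliqueIn (_∈ D) (suc w′)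
    ω′ L = ω (subst (CliqueIn (_∈ S)) (+-suc a w′) (clique-join C⊆S D⊆S
      (λ x∈C y∈D → ¬NonAdj⇒Adj (λ { refl → disjoint x∈C y∈D }) (cross x∈C y∈D)) K L))

  -- Induction on the order, bounded by `fuel`. The case of a vertex lying in every `k`-matching
  -- includes that of a nonempty `S` without `k`-matchings.
  matching-clique-bound : ∀ fuel {k w S} → length S ≤ fuel → Unique S →
    NoIndependentTriple (_∈ S) → k ≤ 7 → ¬ Matching (_∈ S) (suc k) → ¬ CliqueIn (_∈ S) (suc w) →
    length S ≤ w + excess k
  matching-clique-bound _ {S = []} _ _ _ _ _ _ = z≤n
  matching-clique-bound (suc fuel) {k} {w} {S@(s₀ ∷ _)} short u tf k≤7 max ω =
    decidable-stable (length S ≤? w + excess k) λ fail →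
    ¬¬-excluded-middle {A = ∃[ v ] v ∈ S × ¬ Matching ((_∈ S) ∖ v) k} λ
      { (yes (v , v∈S , unavoidable)) → fail (removable v∈S unavoidable)
      ; (no ∄) → ¬¬-decidable (Inseparable (_∈ S) k s₀) λ C? →
          let avoidable : ∀ {v} → v ∈ S → ¬ ¬ Matching ((_∈ S) ∖ v) k
              avoidable {v} v∈S ¬M = ∄ (v , v∈S , ¬M)
          -- A `k`-matching avoiding `s₀` also shows that `k` is exactly the matching number.
          in avoidable (here refl) λ M → fail (separable C? avoidable (matching-mono proj₁ M)) }
    where
    ih : ∀ {S′ k w} → length S′ < length S → (_∈ S′) ⊆ (_∈ S) → Unique S′ → k ≤ 7 →
      ¬ Matching (_∈ S′) (suc k) → ¬ CliqueIn (_∈ S′) (suc w) → length S′ ≤ w + excess k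
    ih shorter sub u′ = matching-clique-bound fuel (≤-pred (≤-trans shorter short)) u′
      (λ p q r → tf (sub p) (sub q) (sub r))

    -- Deleting `v` lowers the bound on the matching number by one, and `excess` falls by at least
    -- one. If `k = 0`, the empty matching avoids `v`.
    removable : ∀ {v} → v ∈ S → ¬ Matching ((_∈ S) ∖ v) k → length S ≤ w + excess k
    removable = remove k≤7
      where
      remove : ∀ {k v} → k ≤ 7 → v ∈ S → ¬ Matching ((_∈ S) ∖ v) k → length S ≤ w + excess k
      remove {zero} _ _ ¬M = contradiction [] ¬M
      remove {suc k} {v} k≤7 v∈S ¬M = begin
        length S                       ≤⟨ length-delete-≥ v u ⟩
        suc (length (delete v S))      ≤⟨ s≤s (ih (length-delete-< v∈S) (proj₁ ∘ ∈-delete⁻) (unique-delete v u)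
                                            (≤-trans (n≤1+n k) k≤7) (¬M ∘ matching-mono ∈-delete⁻)
                                            (ω ∘ clique-mono (proj₁ ∘ ∈-delete⁻))) ⟩
        suc (w + excess k)             ≡⟨ ≡.sym (+-suc w (excess k)) ⟩
        w + suc (excess k)             ≤⟨ +-monoʳ-≤ w (s≤s (+-monoʳ-≤ k (⌊n/2⌋-mono (n≤1+n k)))) ⟩
        w + excess (suc k)             ∎
        where open ≤-Reasoning

    -- The class of `s₀` contains `s₀`, so the rest is shorter. Non-adjacent vertices are
    -- inseparable, so by transitivity all pairs across are adjacent.
    separable : Decidable (Inseparable (_∈ S) k s₀) → (∀ {v} → v ∈ S → ¬ ¬ Matching ((_∈ S) ∖ v) k) →
      Matching (_∈ S) k → length S ≤ w + excess k
    separable C? avoidable M = ≤-trans (≤-reflexive (≡.sym (length-filter-+ C? S)))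
      (split-bound cover (proj₁ ∘ ∈-filter⁻ C?) (proj₁ ∘ ∈-filter⁻ D?)
        (λ c d → proj₂ (∈-filter⁻ D? d) (proj₂ (∈-filter⁻ C? c)))
        (Unique.filter⁺ C? u) (λ p q r → tf (C⊆S p) (C⊆S q) (C⊆S r)) k≤7 cross tight max ω M
        (ih shorter (proj₁ ∘ ∈-filter⁻ D?) (Unique.filter⁺ D? u)))
      where
      D? : Decidable (λ v → ¬ Inseparable (_∈ S) k s₀ v)
      D? = ¬? ∘ C?
      C⊆S : (_∈ filter C? S) ⊆ (_∈ S)
      C⊆S = proj₁ ∘ ∈-filter⁻ C?
      shorter : length (filter D? S) < length S
      shorter = filter-notAll D? S (here (λ sep → sep (inj₁ refl)))
      cover : (_∈ S) ⊆ (λ v → v ∈ filter C? S ⊎ v ∈ filter D? S)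
      cover {v} v∈S with C? v
      ... | yes c = inj₁ (∈-filter⁺ C? v∈S c)
      ... | no d = inj₂ (∈-filter⁺ D? v∈S d)
      cross : ∀ {x y} → x ∈ filter C? S → y ∈ filter D? S → ¬ NonAdj x y
      cross x∈ y∈ x-y with x∈S , c ← ∈-filter⁻ C? x∈ | y∈S , d ← ∈-filter⁻ D? y∈ =
        d (inseparable-trans max x∈S (avoidable x∈S) c (nonadjacent⇒inseparable max x∈S y∈S x-y))
      tight : ∀ {x y} → x ∈ filter C? S → y ∈ filter C? S → x ≢ y → ¬ Matching ((_∈ S) ∖ x ∖ y) k
      tight x∈ y∈ x≢y with x∈S , c ← ∈-filter⁻ C? x∈ | y∈S , d ← ∈-filter⁻ C? y∈ =
        [ (λ x≡y → contradiction x≡y x≢y) , id ]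
          (inseparable-trans max (here refl) (avoidable (here refl)) (inseparable-sym c) d)

  -- Colourings of a vertex set

  -- With numbers as colours and `f` total, the same function serves for subsets and for more
  -- colours.
  Colouring : Pred (Fin n) 0ℓ → ℕ → Set
  Colouring P c = Σ (Fin n → ℕ) λ f → (∀ {v} → P v → f v < c) × (∀ {u v} → P u → P v → Adj G u v → f u ≢ f v)

  colouring-mono : ∀ {P Q c d} → Q ⊆ P → c ≤ d → Colouring P c → Colouring Q d
  colouring-mono sub c≤d (f , f<c , proper) =
    f , (λ q → ≤-trans (f<c (sub q)) c≤d) , λ p q → proper (sub p) (sub q)

  colour-class : ∀ {P B : Pred (Fin n) 0ℓ} {c} → Decidable B → (∀ {u v} → B u → B v → ¬ Adj G u v) →
    Colouring (λ v → P v × ¬ B v) c → Colouring P (suc c)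
  colour-class {P} {B} {c} B? independent (f , f<c , proper) = g , g<1+c , g-proper
    where
    g : Fin n → ℕ
    g v with B? v
    ... | yes _ = c
    ... | no _ = f v
    g<1+c : ∀ {v} → P v → g v < suc c
    g<1+c {v} p with B? v
    ... | yes _ = ≤-refl
    ... | no ¬b = m≤n⇒m≤1+n (f<c (p , ¬b))
    g-proper : ∀ {u v} → P u → P v → Adj G u v → g u ≢ g v
    g-proper {u} {v} p q a with B? u | B? v
    ... | yes b | yes b′ = contradiction a (independent b b′)
    ... | yes b | no ¬b′ = >⇒≢ (f<c (q , ¬b′))
    ... | no ¬b | yes b′ = <⇒≢ (f<c (p , ¬b))
    ... | no ¬b | no ¬b′ = proper (p , ¬b) (q , ¬b′) a

  colouring-discrete : ∀ S → Colouring (_∈ S) (length S)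
  colouring-discrete [] = (λ _ → 0) , (λ ()) , λ ()
  colouring-discrete (x ∷ S) = colour-class (Fin._≟ x) (λ { refl refl → Adj-irrefl })
    (colouring-mono (λ { (here refl , v≢v) → contradiction refl v≢v ; (there v∈S , _) → v∈S }) ≤-refl
      (colouring-discrete S))

  -- The ends of a matching edge share a colour, every other vertex has its own. An inequality is
  -- claimed, as `S` may have repetitions.
  colouring-from-matching : ∀ {k S} → Matching (_∈ S) k → ∃[ c ] c + k ≤ length S × Colouring (_∈ S) c
  colouring-from-matching {S = S} [] = length S , ≤-reflexive (+-identityʳ _) , colouring-discrete S
  colouring-from-matching {suc k} {S} (edge {x = x} {y} x∈S y∈S (x≢y , ¬a) M)
    with c , c+k≤ , f ← colouring-from-matching {S = delete y (delete x S)}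
           (matching-mono (λ ((s , p) , q) → ∈-delete⁺ (∈-delete⁺ (s , p) , q)) M)
    = suc c
    , ≤-trans (s≤s (≤-trans (≤-reflexive (+-suc c k)) (s≤s c+k≤)))
        (≤-trans (s≤s (length-delete-< (∈-delete⁺ (y∈S , x≢y ∘ ≡.sym)))) (length-delete-< x∈S))
    , colour-class (λ v → v Fin.≟ x ⊎-dec v Fin.≟ y)
        (λ { (inj₁ refl) (inj₁ refl) → Adj-irrefl ; (inj₁ refl) (inj₂ refl) → ¬a
           ; (inj₂ refl) (inj₁ refl) → ¬a ∘ Adj-sym ; (inj₂ refl) (inj₂ refl) → Adj-irrefl })
        (colouring-mono (λ (s , ¬b) → ∈-delete⁺ (∈-delete⁺ (s , ¬b ∘ inj₁) , ¬b ∘ inj₂)) ≤-refl f)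

  -- Independent triples and the induction on j

  IndependentTriple : Pred (Fin n) 0ℓ → Set
  IndependentTriple P = ∃[ x ] ∃[ y ] ∃[ z ] P x × P y × P z × NonAdj x y × NonAdj x z × NonAdj y z

  remove-triple : ∀ {c S} → IndependentTriple (_∈ S) → ¬ Colouring (_∈ S) (suc c) →
    ∃[ S′ ] (Unique S → Unique S′) × (_∈ S′) ⊆ (_∈ S) × 3 + length S′ ≤ length S × ¬ Colouring (_∈ S′) c
  remove-triple {S = S} (x , y , z , x∈S , y∈S , z∈S , (x≢y , ¬xy) , (x≢z , ¬xz) , (y≢z , ¬yz)) χ =
    delete z (delete y (delete x S))
    , (λ u → unique-delete z (unique-delete y (unique-delete x u)))
    , proj₁ ∘ ∈-delete⁻ ∘ proj₁ ∘ ∈-delete⁻ ∘ proj₁ ∘ ∈-delete⁻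
    , ≤-trans (s≤s (s≤s (length-delete-< (∈-delete⁺ (∈-delete⁺ (z∈S , x≢z ∘ ≡.sym) , y≢z ∘ ≡.sym)))))
        (≤-trans (s≤s (length-delete-< (∈-delete⁺ (y∈S , x≢y ∘ ≡.sym)))) (length-delete-< x∈S))
    , λ f → χ (colour-class (λ v → v Fin.≟ x ⊎-dec v Fin.≟ y ⊎-dec v Fin.≟ z)
        (λ { (inj₁ refl) (inj₁ refl) → Adj-irrefl
           ; (inj₁ refl) (inj₂ (inj₁ refl)) → ¬xy
           ; (inj₁ refl) (inj₂ (inj₂ refl)) → ¬xz
           ; (inj₂ (inj₁ refl)) (inj₁ refl) → ¬xy ∘ Adj-sym
           ; (inj₂ (inj₁ refl)) (inj₂ (inj₁ refl)) → Adj-irrefl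
           ; (inj₂ (inj₁ refl)) (inj₂ (inj₂ refl)) → ¬yz
           ; (inj₂ (inj₂ refl)) (inj₁ refl) → ¬xz ∘ Adj-sym
           ; (inj₂ (inj₂ refl)) (inj₂ (inj₁ refl)) → ¬yz ∘ Adj-sym
           ; (inj₂ (inj₂ refl)) (inj₂ (inj₂ refl)) → Adj-irrefl })
        (colouring-mono (λ (s , ¬b) → ∈-delete⁺ (∈-delete⁺ (∈-delete⁺ (s , ¬b ∘ inj₁) , ¬b ∘ inj₂ ∘ inj₁)
                                                  , ¬b ∘ inj₂ ∘ inj₂)) ≤-refl f))

  uncolourable⇒large : ∀ {c S} → ¬ Colouring (_∈ S) c → suc c ≤ length S
  uncolourable⇒large {S = S} χ = ≰⇒> λ small → χ (colouring-mono id small (colouring-discrete S))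

  -- Let |S| = c + 1 + k. A matching with k + 1 edges would give a `c`-colouring. So if k ≤ 2j + 1 ≤
  -- 7, then |S| ≤ w + k + j, that is, c + 1 ≤ w + j, contrary to the hypothesis.
  order-bound-α≤2 : ∀ {c w j S} → Unique S → NoIndependentTriple (_∈ S) → j ≤ 3 →
    ¬ Colouring (_∈ S) c → ¬ CliqueIn (_∈ S) (suc w) → w + suc j ≤ suc c →
    suc c + (suc j + suc j) ≤ length S
  order-bound-α≤2 {c} {w} {j} {S} u tf j≤3 χ ω w+1+j≤1+c
    with k , 1+c+k≡ ← m≤n⇒∃[o]m+o≡n (uncolourable⇒large χ)
    with suc j + suc j ≤? k
  ... | yes large = ≤-trans (+-monoʳ-≤ (suc c) large) (≤-reflexive 1+c+k≡)
  ... | no ¬large = contradiction (≤-trans w+1+j≤1+c 1+c≤w+j)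
                      (<⇒≱ (≤-reflexive (≡.sym (+-suc w j))))
    where
    open ≤-Reasoning
    open +-*-Solver
    k≤1+2j : k ≤ suc (j + j)
    k≤1+2j = ≤-trans (≤-pred (≰⇒> ¬large)) (≤-reflexive (+-suc j j))
    no-matching : ¬ Matching (_∈ S) (suc k)
    no-matching M with d , d+1+k≤ , f ← colouring-from-matching M =
      χ (colouring-mono id (+-cancelʳ-≤ (suc k) d c (≤-trans d+1+k≤
          (≤-reflexive (≡.trans (≡.sym 1+c+k≡) (≡.sym (+-suc c k)))))) f)
    1+c≤w+j : suc c ≤ w + j
    1+c≤w+j = +-cancelʳ-≤ k _ _ (begin
      suc c + k               ≡⟨ 1+c+k≡ ⟩
      length S                ≤⟨ matching-clique-bound (length S) ≤-refl u tf
                                   (≤-trans k≤1+2j (s≤s (+-mono-≤ j≤3 j≤3))) no-matching ω ⟩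
      w + (k + ⌊ k /2⌋)       ≤⟨ +-monoʳ-≤ w (+-monoʳ-≤ k (⌊n/2⌋-mono k≤1+2j)) ⟩
      w + (k + ⌊ suc (j + j) /2⌋) ≡⟨ cong (λ h → w + (k + h)) (⌊1+n+n/2⌋≡n j) ⟩
      w + (k + j)             ≡⟨ solve 3 (λ w k j → w :+ (k :+ j) := w :+ j :+ k) refl w k j ⟩
      w + j + k               ∎)
      where
      ⌊1+n+n/2⌋≡n : ∀ n → ⌊ suc (n + n) /2⌋ ≡ n
      ⌊1+n+n/2⌋≡n n = ≡.sym (n≡⌈n+n/2⌉ n)

  -- Removing an independent triple lowers `c` and `j` by one and keeps `w`; its three vertices pay
  -- for 1 in `c` and 2 in `j + j`.
  order-bound : ∀ j {c w S} → Unique S → j ≤ 4 →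
    ¬ Colouring (_∈ S) c → ¬ CliqueIn (_∈ S) (suc w) → w + j ≤ suc c → suc c + (j + j) ≤ length S
  order-bound zero _ _ χ _ _ = ≤-trans (≤-reflexive (+-identityʳ _)) (uncolourable⇒large χ)
  order-bound (suc j) {c} {w} {S} u (s≤s j≤3) χ ω w+1+j≤1+c =
    decidable-stable (suc c + (suc j + suc j) ≤? length S) λ fail →
    ¬¬-excluded-middle {A = IndependentTriple (_∈ S)} λ
      { (yes t) → fail (with-triple t χ (≤-pred (≤-trans (≤-reflexive (≡.sym (+-suc w j))) w+1+j≤1+c)))
      ; (no ∄) → fail (order-bound-α≤2 u
          (λ p q r xy xz yz → ∄ (_ , _ , _ , p , q , r , xy , xz , yz)) j≤3 χ ω w+1+j≤1+c) }
    where
    with-triple : ∀ {c} → IndependentTriple (_∈ S) → ¬ Colouring (_∈ S) c → w + j ≤ c →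
      suc c + (suc j + suc j) ≤ length S
    -- Without colours the hypothesis forces `w = 0`, but `x` alone is a clique of order 1.
    with-triple {zero} (x , _ , _ , x∈S , _) _ w+j≤0 =
      contradiction (x∈S ∷ []) (subst (λ w → ¬ CliqueIn (_∈ S) (suc w)) (m+n≡0⇒m≡0 w (n≤0⇒n≡0 w+j≤0)) ω)
    with-triple {suc c} t χ w+j≤1+c with S′ , u′ , sub , |S′| , χ′ ← remove-triple t χ = begin
      suc (suc c) + (suc j + suc j)  ≡⟨ solve 2 (λ c j → con 2 :+ c :+ (con 1 :+ j :+ (con 1 :+ j))
                                            := con 3 :+ (con 1 :+ c :+ (j :+ j))) refl c j ⟩
      3 + (suc c + (j + j))          ≤⟨ +-monoʳ-≤ 3 (order-bound j (u′ u) (m≤n⇒m≤1+n j≤3) χ′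
                                            (ω ∘ clique-mono sub) w+j≤1+c) ⟩
      3 + length S′                  ≤⟨ |S′| ⟩
      length S                       ∎
      where
      open ≤-Reasoning
      open +-*-Solver

  -- Translation from `Clique` and `Arrows2`; the lower bound

  clique-from-map : ∀ {k} (f : Fin k → Fin n) → (∀ i j → ¬ i ≡ j → Adj G (f i) (f j)) → Clique G k
  clique-from-map f a = f , (λ {i} {j} fi≡fj → decidable-stable (i Fin.≟ j) λ i≢j →
    Adj-irrefl (subst (Adj G (f i)) (≡.sym fi≡fj) (a i j i≢j))) , a

  cliqueIn⇒clique : ∀ {P k} → CliqueIn P k → Clique G k
  cliqueIn⇒clique K = let f , _ , a = vertices K in clique-from-map f a
    where
    vertices : ∀ {P k} → CliqueIn P k →
      Σ (Fin k → Fin n) λ f → (∀ i → P (f i)) × (∀ i j → ¬ i ≡ j → Adj G (f i) (f j))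
    vertices [] = (λ ()) , (λ ()) , λ ()
    vertices {P} {suc k} (_∷_ {x = x} px K) with f , p , a ← vertices K = g , q , b
      where
      g : Fin (suc k) → Fin n
      g zero = x
      g (suc i) = f i
      q : ∀ i → P (g i)
      q zero = px
      q (suc i) = proj₁ (p i)
      b : ∀ i j → ¬ i ≡ j → Adj G (g i) (g j)
      b zero zero 0≢0 = contradiction refl 0≢0
      b zero (suc j) _ = proj₂ (p j)
      b (suc i) zero _ = Adj-sym (proj₂ (p i))
      b (suc i) (suc j) i≢j = a i j (i≢j ∘ cong suc)

  clique⇒cliqueIn : ∀ {P k} (K : Clique G k) → (∀ i → P (proj₁ K i)) → CliqueIn P k
  clique⇒cliqueIn {k = zero} _ _ = []
  clique⇒cliqueIn {k = suc k} (f , inj , a) p = p zero ∷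
    clique⇒cliqueIn (f ∘ suc , Fin.suc-injective ∘ inj , λ i j i≢j → a (suc i) (suc j) (i≢j ∘ Fin.suc-injective))
      (λ i → p (suc i) , a zero (suc i) λ ())

  MonochromaticEdge : ∀ {r} → (Fin n → Fin r) → Set
  MonochromaticEdge c = ∃₂ λ u v → Adj G u v × c u ≡ c v

  monochromatic-edge : ∀ {r} → Arrows2 G r → ∀ c → MonochromaticEdge c
  monochromatic-edge G→ c with _ , (f , _ , a) , same ← G→ c =
    f zero , f (suc zero) , a zero (suc zero) (λ ()) , ≡.trans (same zero) (≡.sym (same (suc zero)))

  arrows-from-edges : ∀ {r} → (∀ c → MonochromaticEdge {r} c) → Arrows2 G r
  arrows-from-edges edges c with u , v , a , cu≡cv ← edges c =
    c v , clique-from-map ends ends-adjacent , same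
    where
    ends : Fin 2 → Fin n
    ends zero = u
    ends (suc zero) = v
    ends-adjacent : ∀ i j → ¬ i ≡ j → Adj G (ends i) (ends j)
    ends-adjacent zero zero 0≢0 = contradiction refl 0≢0
    ends-adjacent zero (suc zero) _ = a
    ends-adjacent (suc zero) zero _ = Adj-sym a
    ends-adjacent (suc zero) (suc zero) 1≢1 = contradiction refl 1≢1
    same : ∀ i → c (ends i) ≡ c v
    same zero = cu≡cv
    same (suc zero) = refl

  arrows⇒¬colouring : ∀ {P r} → Arrows2 G r → (∀ v → P v) → ¬ Colouring P r
  arrows⇒¬colouring G→ p (f , f<r , proper)
    with u , v , a , same ← monochromatic-edge G→ (λ v → fromℕ< (f<r (p v))) =
    proper (p u) (p v) a (Fin.fromℕ<-injective _ _ _ _ same)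

  order-lower-bound : ∀ {r} → 5 ≤ r → InHv G r (r ∸ 2) → r + 9 ≤ n
  order-lower-bound {r} 5≤r (G→ , ω) with w , refl ← m≤n⇒∃[o]m+o≡n (≤-trans (m≤n+m 3 2) 5≤r) = begin
    3 + w + 9                ≡⟨ solve 1 (λ w → con 3 :+ w :+ con 9 := con 4 :+ w :+ con 8) refl w ⟩
    -- Here `r = 3 + w` and cliques have order at most `w`, so `j = 4` is the largest choice with
    -- `w + j ≤ suc r`.
    suc (3 + w) + 8          ≤⟨ order-bound 4 (Unique.allFin⁺ n) ≤-refl
                                  (arrows⇒¬colouring G→ ∈-allFin) (ω ∘ cliqueIn⇒clique)
                                  (≤-reflexive (+-comm w 4)) ⟩
    length (allFin n)        ≡⟨ length-tabulate id ⟩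
    n                        ∎
    where
    open ≤-Reasoning
    open +-*-Solver

-- Graphs of decidable relations, indicators, least numbers

does⇒ : ∀ {A : Set} (A? : Dec A) → does A? ≡ true → A
does⇒ (yes a) _ = a

relationGraph : ∀ {n} {R : Rel (Fin n) 0ℓ} → Decidable₂ R → Symmetric R → (∀ v → ¬ R v v) → Graph n
relationGraph {R = R} R? R-sym R-irrefl = record
  { adj = λ u v → does (R? u v)
  ; sym = λ u v → adj-sym u v
  ; irrefl = λ v → dec-false (R? v v) (R-irrefl v)
  }
  where
  adj-sym : ∀ u v → does (R? u v) ≡ does (R? v u)
  adj-sym u v with R? u v
  ... | yes r = ≡.sym (dec-true (R? v u) (R-sym r))
  ... | no ¬r = ≡.sym (dec-false (R? v u) (¬r ∘ R-sym))

-- Values in `Fin 2` let `combine` and `funToFin` code flags and sets as numbers.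
indicator : ∀ {A : Set} → Dec A → Fin 2
indicator A? = if does A? then suc zero else zero

indicator-transfer : ∀ {A B : Set} (A? : Dec A) (B? : Dec B) → indicator A? ≡ indicator B? → A → B
indicator-transfer (yes _) (yes b) _ _ = b
indicator-transfer (no ¬a) _ _ a = contradiction a ¬a

indicator-yes : ∀ {A : Set} (A? : Dec A) → A → indicator A? ≡ suc zero
indicator-yes (yes _) _ = refl
indicator-yes (no ¬a) a = contradiction a ¬a

indicator-yes⁻ : ∀ {A : Set} (A? : Dec A) → indicator A? ≡ suc zero → A
indicator-yes⁻ (yes a) _ = a

least : ∀ {P : Pred ℕ 0ℓ} → Decidable P → ∀ {n} → P n → ∃[ m ] P m × (∀ k → P k → m ≤ k)
least P? {zero} p = 0 , p , λ _ _ → z≤n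
least P? {suc n} p with P? 0
... | yes p₀ = 0 , p₀ , λ _ _ → z≤n
... | no ¬p₀ with m , pm , minimal ← least (P? ∘ suc) p = suc m , pm , λ
  { zero p₀ → contradiction p₀ ¬p₀ ; (suc k) pk → s≤s (minimal k pk) }

-- Deciding cliques and arrowing

module _ {n : ℕ} (G : Graph n) where

  clique-pick : ∀ {P k} x → CliqueIn G P (suc k) →
    CliqueIn G (P ∖ x) (suc k) ⊎ (P x × CliqueIn G (λ y → P y × Adj G x y) k)
  clique-pick x (_∷_ {x = y} py K) with y Fin.≟ x
  ... | yes refl = inj₂ (py , K)
  clique-pick x (py ∷ []) | no y≢x = inj₁ ((py , y≢x) ∷ [])
  clique-pick x (py ∷ K@(_ ∷ _)) | no y≢x with clique-pick x K
  ... | inj₁ K′ = inj₁ ((py , y≢x) ∷ clique-mono G (λ ((p , a) , b) → (p , b) , a) K′)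
  ... | inj₂ ((px , a) , K′) =
    inj₂ (px , (py , Adj-sym G a) ∷ clique-mono G (λ ((p , b) , c) → (p , c) , b) K′)

  -- Branches on whether the clique uses `x`; if so, the rest lies among the neighbours of `x`. This
  -- search also evaluates the clique number of the 17-vertex graph.
  cliqueIn? : ∀ k S → Dec (CliqueIn G (_∈ S) k)
  cliqueIn? zero S = yes []
  cliqueIn? (suc k) [] = no λ { (() ∷ _) }
  cliqueIn? (suc k) (x ∷ S) =
    map′ extend restrict (cliqueIn? k (filter (Adj? G x) S) ⊎-dec cliqueIn? (suc k) S)
    where
    extend : CliqueIn G (_∈ filter (Adj? G x) S) k ⊎ CliqueIn G (_∈ S) (suc k) →
      CliqueIn G (_∈ x ∷ S) (suc k)
    extend (inj₁ K) = here refl ∷ clique-mono G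
      (λ v∈ → let v∈S , a = ∈-filter⁻ (Adj? G x) v∈ in there v∈S , a) K
    extend (inj₂ K) = clique-mono G there K
    restrict : CliqueIn G (_∈ x ∷ S) (suc k) →
      CliqueIn G (_∈ filter (Adj? G x) S) k ⊎ CliqueIn G (_∈ S) (suc k)
    restrict K with clique-pick x K
    ... | inj₁ K′ = inj₂ (clique-mono G
      (λ { (here refl , v≢v) → contradiction refl v≢v ; (there v∈S , _) → v∈S }) K′)
    ... | inj₂ (_ , K′) = inj₁ (clique-mono G
      (λ { (here refl , a) → contradiction a (Adj-irrefl G)
         ; (there v∈S , a) → ∈-filter⁺ (Adj? G x) v∈S a }) K′)

  clique⇒cliqueIn-allFin : ∀ {k} → Clique G k → CliqueIn G (_∈ allFin n) k
  clique⇒cliqueIn-allFin K = clique⇒cliqueIn G K (λ _ → ∈-allFin _)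

  clique? : ∀ k → Dec (Clique G k)
  clique? k = map′ (cliqueIn⇒clique G) clique⇒cliqueIn-allFin (cliqueIn? k (allFin n))

  cliqueNumberBelow-mono : ∀ {k l} → k ≤ l → CliqueNumberBelow G k → CliqueNumberBelow G l
  cliqueNumberBelow-mono k≤l ω K =
    ω (cliqueIn⇒clique G (clique-shrink G k≤l (clique⇒cliqueIn-allFin K)))

  monochromaticEdge? : ∀ {r} (c : Fin n → Fin r) → Dec (MonochromaticEdge G c)
  monochromaticEdge? c = Fin.any? λ u → Fin.any? λ v → Adj? G u v ×-dec (c u Fin.≟ c v)

  arrows? : ∀ r → Dec (Arrows2 G r)
  arrows? r = map′
    (λ (edges : ∀ i → MonochromaticEdge G (finToFun {r} {n} i)) → arrows-from-edges G λ c →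
      let (u , v , a , same) = edges (funToFin c) in
      u , v , a , ≡.trans (≡.sym (Fin.finToFun-funToFin c u)) (≡.trans same (Fin.finToFun-funToFin c v)))
    (λ G→ i → monochromatic-edge G G→ (finToFun i))
    (Fin.all? λ i → monochromaticEdge? (finToFun i))

  inHv? : ∀ r q → Dec (InHv G r q)
  inHv? r q = arrows? r ×-dec ¬? (clique? q)

  -- Colouring v also by whether an earlier vertex has the colour of v, a repeated pair of colours
  -- yields three vertices of the same colour.
  arrows-from-no-triple : ∀ {r} → r * 2 < n → NoIndependentTriple G (λ _ → ⊤) → Arrows2 G r
  arrows-from-no-triple {r} 2r<n tf = arrows-from-edges G λ c →
    decidable-stable (monochromaticEdge? c) (not-proper c)
    where
    not-proper : (c : Fin n → Fin r) → ¬ ¬ MonochromaticEdge G c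
    not-proper c proper =
      let (u , v , u<v , same) = Fin.pigeonhole 2r<n (λ v → combine (c v) (indicator (repeats? v)))
          (cu≡cv , flag) = Fin.combine-injective (c u) _ (c v) _ same
          (w , w<u , cw≡cu) = indicator-transfer (repeats? v) (repeats? u) (≡.sym flag) (u , u<v , cu≡cv)
      in tf _ _ _ (nonadj (Fin.<⇒≢ w<u) cw≡cu)
                  (nonadj (Fin.<⇒≢ (Fin.<-trans w<u u<v)) (≡.trans cw≡cu cu≡cv))
                  (nonadj (Fin.<⇒≢ u<v) cu≡cv)
      where
      repeats? : ∀ v → Dec (∃[ u ] u Fin.< v × c u ≡ c v)
      repeats? v = Fin.any? λ u → (u Fin.<? v) ×-dec (c u Fin.≟ c v)
      nonadj : ∀ {x y} → x ≢ y → c x ≡ c y → NonAdj G x y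
      nonadj x≢y same = x≢y , λ a → proper (_ , _ , a , same)

-- A graph is recovered from its code only up to equivalent adjacency, not up to equality.
inHv-resp : ∀ {n r q} {G H : Graph n} → (∀ {u v} → Adj G u v → Adj H u v) →
  (∀ {u v} → Adj H u v → Adj G u v) → InHv G r q → InHv H r q
inHv-resp {G = G} {H} to from (G→ , ω) =
  arrows-from-edges H (λ c → let (u , v , a , same) = monochromatic-edge G G→ c in u , v , to a , same) ,
  λ (f , inj , a) → ω (f , inj , λ i j i≢j → from (a i j i≢j))

-- Search through all graphs of a given order

module _ {n : ℕ} where

  -- Asking for both orientations and `u ≢ v` turns every 0-1 matrix into a graph.
  Coded : (Fin n → Fin n → Fin 2) → Rel (Fin n) 0ℓ
  Coded e u v = u ≢ v × e u v ≡ suc zero × e v u ≡ suc zero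

  coded? : ∀ e → Decidable₂ (Coded e)
  coded? e u v = ¬? (u Fin.≟ v) ×-dec (e u v Fin.≟ suc zero) ×-dec (e v u Fin.≟ suc zero)

  graphOf : (Fin n → Fin n → Fin 2) → Graph n
  graphOf e = relationGraph (coded? e) (λ (u≢v , p , q) → u≢v ∘ ≡.sym , q , p) (λ v (v≢v , _) → v≢v refl)

  encode : Graph n → Fin (2 ^ (n * n))
  encode G = funToFin λ i → let (u , v) = remQuot n i in indicator (Adj? G u v)

  decode : Fin (2 ^ (n * n)) → Fin n → Fin n → Fin 2
  decode i u v = finToFun i (combine u v)

  decode-encode : ∀ G u v → decode (encode G) u v ≡ indicator (Adj? G u v)
  decode-encode G u v = ≡.trans (Fin.finToFun-funToFin _ (combine u v))
    (cong (λ (u , v) → indicator (Adj? G u v)) (Fin.remQuot-combine u v))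

  inHv-decode-encode : ∀ {r q} G → InHv G r q → InHv (graphOf (decode (encode G))) r q
  inHv-decode-encode G = inHv-resp {G = G} {H = graphOf (decode (encode G))}
    (λ {u} {v} a → dec-true (coded? (decode (encode G)) u v)
      ( (λ { refl → Adj-irrefl G a })
      , ≡.trans (decode-encode G u v) (indicator-yes (Adj? G u v) a)
      , ≡.trans (decode-encode G v u) (indicator-yes (Adj? G v u) (Adj-sym G a))))
    (λ {u} {v} h → let (_ , p , _) = does⇒ (coded? (decode (encode G)) u v) h in
      indicator-yes⁻ (Adj? G u v) (≡.trans (≡.sym (decode-encode G u v)) p))

inHv-exists? : ∀ r q n → Dec (Σ (Graph n) λ G → InHv G r q)
inHv-exists? r q n = map′ (λ (i , h) → graphOf (decode i) , h)
  (λ (G , h) → encode G , inHv-decode-encode G h)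
  (Fin.any? λ i → inHv? (graphOf {n} (decode i)) r q)

-- The shift graph on the pairs i < j; the remaining pairs are isolated vertices.
module Shift (N : ℕ) where

  Step : Rel (Fin N × Fin N) 0ℓ
  Step (i , j) (k , l) = i Fin.< j × j ≡ k × k Fin.< l

  step? : Decidable₂ Step
  step? (i , j) (k , l) = (i Fin.<? j) ×-dec (j Fin.≟ k) ×-dec (k Fin.<? l)

  Linked : Rel (Fin N × Fin N) 0ℓ
  Linked p q = Step p q ⊎ Step q p

  step-irrefl : ∀ p → ¬ Step p p
  step-irrefl _ (i<j , refl , _) = Fin.<-irrefl refl i<j

  linked-irrefl : ∀ p → ¬ Linked p p
  linked-irrefl p = [ step-irrefl p , step-irrefl p ]

  -- The pairs are (i, j), (j, k), (k, l) with i < j < k < l; a link of the outer two needs j = k or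
  -- l = i.
  path-not-closed : ∀ p q s → Step p q → Step q s → ¬ Linked p s
  path-not-closed _ _ _ (_ , refl , _) (j<k , refl , _) (inj₁ (_ , refl , _)) = Fin.<-irrefl refl j<k
  path-not-closed _ _ _ (i<j , refl , _) (j<k , refl , k<l) (inj₂ (_ , refl , _)) =
    Fin.<-irrefl refl (Fin.<-trans i<j (Fin.<-trans j<k k<l))

  -- Every orientation of a triangle contains a directed path of two steps.
  triangle-free : ∀ p q s → Linked p q → Linked q s → ¬ Linked p s
  triangle-free p q s (inj₁ pq) (inj₁ qs) ps = path-not-closed p q s pq qs ps
  triangle-free p q s (inj₂ qp) (inj₂ sq) ps = path-not-closed s q p sq qp (Sum.swap ps)
  triangle-free p q s (inj₁ pq) (inj₂ sq) (inj₁ ps) = path-not-closed p s q ps sq (inj₁ pq)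
  triangle-free p q s (inj₁ pq) (inj₂ sq) (inj₂ sp) = path-not-closed s p q sp pq (inj₁ sq)
  triangle-free p q s (inj₂ qp) (inj₁ qs) (inj₁ ps) = path-not-closed q p s qp ps (inj₁ qs)
  triangle-free p q s (inj₂ qp) (inj₁ qs) (inj₂ sp) = path-not-closed q s p qs sp (inj₁ qp)

  pair : Fin (N * N) → Fin N × Fin N
  pair = remQuot N

  linked? : ∀ u v → Dec (Linked (pair u) (pair v))
  linked? u v = step? (pair u) (pair v) ⊎-dec step? (pair v) (pair u)

  graph : Graph (N * N)
  graph = relationGraph linked? Sum.swap (linked-irrefl ∘ pair)

  no-triangle : CliqueNumberBelow graph 3
  no-triangle (f , _ , a) =
    triangle-free _ _ _ (linked zero (suc zero) λ ()) (linked (suc zero) (suc (suc zero)) λ ())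
      (linked zero (suc (suc zero)) λ ())
    where
    linked : ∀ i j → ¬ i ≡ j → Linked (pair (f i)) (pair (f j))
    linked i j i≢j = does⇒ (linked? (f i) (f j)) (a i j i≢j)

  -- The sets of colours of the pairs (i , _), for i < N, would otherwise be pairwise distinct.
  arrows : ∀ {r} → 2 ^ r < N → Arrows2 graph r
  arrows {r} 2^r<N = arrows-from-edges graph monochromatic
    where
    monochromatic : (c : Fin (N * N) → Fin r) → MonochromaticEdge graph c
    monochromatic c =
      let (i , j , i<j , same) = Fin.pigeonhole 2^r<N (funToFin ∘ λ i a → indicator (used? i a))
          a = c (combine i j)
          -- The colour of (i, j) belongs to the set of i, hence to that of j: some pair (j, k) has
          -- it too.
          (k , j<k , cjk≡) = indicator-transfer (used? i a) (used? j a)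
            (≡.trans (≡.sym (Fin.finToFun-funToFin _ a))
              (≡.trans (cong (λ s → finToFun s a) same) (Fin.finToFun-funToFin _ a)))
            (j , i<j , refl)
      in combine i j , combine j k
       , dec-true (linked? (combine i j) (combine j k)) (inj₁
           (subst₂ Step (≡.sym (Fin.remQuot-combine i j)) (≡.sym (Fin.remQuot-combine j k))
             (i<j , refl , j<k)))
       , ≡.sym cjk≡
      where
      used? : ∀ i a → Dec (∃[ j ] i Fin.< j × c (combine i j) ≡ a)
      used? i a = Fin.any? λ j → (i Fin.<? j) ×-dec (c (combine i j) Fin.≟ a)

inHv-shift : ∀ {r q} → 3 ≤ q → ∃[ n ] Σ (Graph n) λ G → InHv G r q
inHv-shift {r} 3≤q = _ , graph , arrows ≤-refl , cliqueNumberBelow-mono graph 3≤q no-triangle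
  where open Shift (suc (2 ^ r))

-- Cones and the sharp examples

cone : ∀ {n} → Graph n → Graph (suc n)
cone {n} G = record { adj = a ; sym = a-sym ; irrefl = a-irrefl }
  where
  a : Fin (suc n) → Fin (suc n) → Bool
  a zero zero = false
  a zero (suc _) = true
  a (suc _) zero = true
  a (suc u) (suc v) = adj G u v
  a-sym : ∀ u v → a u v ≡ a v u
  a-sym zero zero = refl
  a-sym zero (suc _) = refl
  a-sym (suc _) zero = refl
  a-sym (suc u) (suc v) = sym G u v
  a-irrefl : ∀ v → a v v ≡ false
  a-irrefl zero = refl
  a-irrefl (suc v) = irrefl G v

-- Either the colour of the apex recurs, next to the apex, or `G` is coloured with the other `r`
-- colours.
cone-arrows : ∀ {n r} {G : Graph n} → Arrows2 G r → Arrows2 (cone G) (suc r)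
cone-arrows {n} {r} {G} G→ = arrows-from-edges (cone G) monochromatic
  where
  monochromatic : (c : Fin (suc n) → Fin (suc r)) → MonochromaticEdge (cone G) c
  monochromatic c with Fin.any? (λ v → c zero Fin.≟ c (suc v))
  ... | yes (v , same) = zero , suc v , refl , same
  ... | no ∄ = let (u , v , a , same) = monochromatic-edge G G→ (λ v → punchOut (∄ ∘ (v ,_)))
               in suc u , suc v , a , Fin.punchOut-injective (∄ ∘ (u ,_)) (∄ ∘ (v ,_)) same

cone-clique⁻ : ∀ {n k} (G : Graph n) {P} → P ⊆ (_≢ zero) → CliqueIn (cone G) P k → CliqueIn G (P ∘ suc) k
cone-clique⁻ G _ [] = []
cone-clique⁻ G P≢0 (_∷_ {x = zero} p _) = contradiction refl (P≢0 p)
cone-clique⁻ G P≢0 (_∷_ {x = suc x} p K) = p ∷ cone-clique⁻ G (P≢0 ∘ proj₁) K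

cone-inHv : ∀ {n r q} {G : Graph n} → InHv G r q → InHv (cone G) (suc r) (suc q)
cone-inHv {q = q} {G} (G→ , ω) = cone-arrows {G = G} G→ , λ K → ω (cliqueIn⇒clique G (reduce K))
  where
  reduce : Clique (cone G) (suc q) → CliqueIn G (λ _ → ⊤) q
  reduce K with clique-pick (cone G) zero (clique⇒cliqueIn (cone G) {λ _ → ⊤} K (λ _ → tt))
  ... | inj₁ K′ = clique-mono G _ (clique-shrink G (n≤1+n q) (cone-clique⁻ G proj₂ K′))
  ... | inj₂ (_ , K′) = clique-mono G _ (cone-clique⁻ G (λ { (_ , ()) refl }) K′)

-- The complement of a triangle-free graph on 17 vertices without independent 6-sets, a witness of
-- R(3,6) > 17; the permutation (0 1 2 3)(4 5 6 7)(8 9 10 11)(12 13 14 15) is an automorphism.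
nonNeighbours : Vec (List ℕ) 17
nonNeighbours =
    (7 ∷ 8 ∷ 13 ∷ 14 ∷ 16 ∷ [])
  ∷ (4 ∷ 9 ∷ 14 ∷ 15 ∷ 16 ∷ [])
  ∷ (5 ∷ 10 ∷ 12 ∷ 15 ∷ 16 ∷ [])
  ∷ (6 ∷ 11 ∷ 12 ∷ 13 ∷ 16 ∷ [])
  ∷ (1 ∷ 8 ∷ 10 ∷ 11 ∷ 12 ∷ [])
  ∷ (2 ∷ 8 ∷ 9 ∷ 11 ∷ 13 ∷ [])
  ∷ (3 ∷ 8 ∷ 9 ∷ 10 ∷ 14 ∷ [])
  ∷ (0 ∷ 9 ∷ 10 ∷ 11 ∷ 15 ∷ [])
  ∷ (0 ∷ 4 ∷ 5 ∷ 6 ∷ 15 ∷ [])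
  ∷ (1 ∷ 5 ∷ 6 ∷ 7 ∷ 12 ∷ [])
  ∷ (2 ∷ 4 ∷ 6 ∷ 7 ∷ 13 ∷ [])
  ∷ (3 ∷ 4 ∷ 5 ∷ 7 ∷ 14 ∷ [])
  ∷ (2 ∷ 3 ∷ 4 ∷ 9 ∷ 14 ∷ [])
  ∷ (0 ∷ 3 ∷ 5 ∷ 10 ∷ 15 ∷ [])
  ∷ (0 ∷ 1 ∷ 6 ∷ 11 ∷ 12 ∷ [])
  ∷ (1 ∷ 2 ∷ 7 ∷ 8 ∷ 13 ∷ [])
  ∷ (0 ∷ 1 ∷ 2 ∷ 3 ∷ [])
  ∷ []

ramseyAdj? : Decidable₂ {A = Fin 17} λ u v → u ≢ v × toℕ v ∉ lookup nonNeighbours u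
ramseyAdj? u v = ¬? (u Fin.≟ v) ×-dec ¬? (toℕ v ∈? lookup nonNeighbours u)

ramseyGraph : Graph 17
ramseyGraph = relationGraph ramseyAdj?
  (λ {u} {v} → from-yes (Fin.all? λ u → Fin.all? λ v → ramseyAdj? u v →-dec ramseyAdj? v u) u v)
  (λ v (v≢v , _) → v≢v refl)

-- Eight independent sets of at most two vertices cover only 16 of the 17; the rest is evaluation.
inHv-ramseyGraph : InHv ramseyGraph 8 6
inHv-ramseyGraph = arrows-from-no-triple ramseyGraph ≤-refl no-triple ,
  from-no (clique? ramseyGraph 6)
  where
  no-triple : NoIndependentTriple ramseyGraph (λ _ → ⊤)
  no-triple {x} {y} {z} _ _ _ = table x y z
    where
    nonAdj? : ∀ u v → Dec (NonAdj ramseyGraph u v)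
    nonAdj? u v = ¬? (u Fin.≟ v) ×-dec ¬? (Adj? ramseyGraph u v)
    table : ∀ x y z → NonAdj ramseyGraph x y → NonAdj ramseyGraph x z → ¬ NonAdj ramseyGraph y z
    table = from-yes (Fin.all? λ x → Fin.all? λ y → Fin.all? λ z →
      nonAdj? x y →-dec nonAdj? x z →-dec ¬? (nonAdj? y z))

-- Each cone raises order, number of colours and clique bound by one, starting from 17, 8 and 6.
inHv-sharp : ∀ d → Σ (Graph (8 + d + 9)) λ G → InHv G (8 + d) (6 + d)
inHv-sharp zero = ramseyGraph , inHv-ramseyGraph
inHv-sharp (suc d) = let (G , h) = inHv-sharp d in cone G , cone-inHv {G = G} h

theorem1p6 : (r : ℕ) → 5 ≤ r →
    Σ ℕ λ m → IsFv r (r ∸ 2) m × (r + 9 ≤ m) × (8 ≤ r → m ≡ r + 9)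
theorem1p6 r 5≤r
  = let (m , (G , h) , minimal) = least (inHv-exists? r (r ∸ 2)) (proj₂ (inHv-shift (∸-monoˡ-≤ 2 5≤r)))
        lower = order-lower-bound G 5≤r h
    in m , ((G , h) , λ n H hH → minimal n (H , hH)) , lower ,
       λ 8≤r → ≤-antisym (minimal (r + 9) (sharp 8≤r)) lower
  where
  sharp : 8 ≤ r → Σ (Graph (r + 9)) λ G → InHv G r (r ∸ 2)
  sharp 8≤r with d , refl ← m≤n⇒∃[o]m+o≡n 8≤r = inHv-sharp d
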